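{- Let $r\ge 0$ be a fixed integer. There is a constant $C>0$ (depending only on $r$) such that every $r$-cross-free hypergraph $H$ on $n$ vertices has at most $C n^{r+1}$ hyperedges (i.e. $\mathcal O(n^{r+1})$ hyperedges).
   Context: Hypergraphs have vertex set $V=[n]$ and are identified with their sets of hyperedges; $\overline A = V\setminus A$. $\mathcal K_r(n)$ is the class of hypergraphs $\mathcal E$ on $V$ satisfying: (R0) every $X\subseteq V$ with $|X|\le r$ is in $\mathcal E$; (R1) $A\in\mathcal E\Rightarrow V\setminus A\in\mathcal E$; (R2) $A,B\in\mathcal E$ and $|A\cap B|\ge r\Rightarrow A\cup B\in\mathcal E$. $\mathcal K^0_r(n)$ is the class of hypergraphs satisfying (R0) and (R1) only. For a hypergraph $H$ on $V$, $\mathrm{cl}_r(H)$ (resp. $\mathrm{cl}^0_r(H)$) is the intersection of all hypergraphs in $\mathcal K_r(n)$ (resp. $\mathcal K^0_r(n)$) containing $H$. Two sets $A,B\subseteq V$ are $r$-orthogonal if $\mathrm{cl}_r(\{A,B\})=\mathrm{cl}^0_r(\{A,B\})$, where $\{A,B\}$ is the hypergraph on $V$ with hyperedges $A$ and $B$. A hypergraph is $r$-cross-free if every pair of its hyperedges is $r$-orthogonal. -}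

module Defs where

open import Data.Bool using (Bool; T; _∨_)
import Data.Bool.Properties as Bool
open import Data.Empty using (⊥)
open import Data.Fin.Subset using (Subset; inside; outside; ∁; _∩_; _∪_; ∣_∣)
open import Data.List using (List; []; _∷_; _++_; map; length; filterᵇ)
open import Data.List.Membership.Propositional using (_∈_)
open import Data.List.Membership.Propositional.Properties
  using (∈-map⁺; ∈-map⁻; ∈-++⁺ˡ; ∈-++⁺ʳ)
open import Data.List.Relation.Unary.All using ([])
open import Data.List.Relation.Unary.AllPairs using ([]; _∷_)
open import Data.List.Relation.Unary.Any using (here)
open import Data.List.Relation.Unary.Unique.Propositional using (Unique)
open import Data.List.Relation.Unary.Unique.Propositional.Properties using (++⁺; map⁺)
open import Data.Nat using (ℕ; zero; suc; _≤_; _≥_)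
open import Data.Product using (∃-syntax; _×_; _,_)
import Data.Vec as Vec
open import Data.Vec.Properties using (≡-dec; ∷-injectiveʳ)
open import Level using (0ℓ)
open import Relation.Binary.Definitions using (DecidableEquality)
open import Relation.Binary.PropositionalEquality using (_≡_; refl)
open import Relation.Nullary using (does)
open import Relation.Unary using (Pred; _≐_)

-- A hypergraph on Fin n is its set of hyperedges, given by a characteristic
-- function on the 2ⁿ subsets of Fin n.
Hypergraph : ℕ → Set
Hypergraph n = Subset n → Bool

infix 4 _∈ᴴ_ _⊆ᴴ_

_∈ᴴ_ : ∀ {n} → Subset n → Hypergraph n → Set
X ∈ᴴ H = T (H X)

_⊆ᴴ_ : ∀ {n} → Hypergraph n → Hypergraph n → Set
H ⊆ᴴ E = ∀ X → X ∈ᴴ H → X ∈ᴴ E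

_≟ˢ_ : ∀ {n} → DecidableEquality (Subset n)
_≟ˢ_ = ≡-dec Bool._≟_

⟅_,_⟆ : ∀ {n} → Subset n → Subset n → Hypergraph n
⟅ A , B ⟆ X = does (X ≟ˢ A) ∨ does (X ≟ˢ B)

subsets : ∀ n → List (Subset n)
subsets zero    = Vec.[] ∷ []
subsets (suc n) = map (outside Vec.∷_) (subsets n) ++ map (inside Vec.∷_) (subsets n)

subsets-complete : ∀ {n} (X : Subset n) → X ∈ subsets n
subsets-complete Vec.[]              = here refl
subsets-complete (outside Vec.∷ X) = ∈-++⁺ˡ (∈-map⁺ _ (subsets-complete X))
subsets-complete (inside  Vec.∷ X) = ∈-++⁺ʳ _ (∈-map⁺ _ (subsets-complete X))

subsets-unique : ∀ n → Unique (subsets n)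
subsets-unique zero    = [] ∷ []
subsets-unique (suc n) =
  ++⁺ (map⁺ ∷-injectiveʳ (subsets-unique n))
      (map⁺ ∷-injectiveʳ (subsets-unique n))
      λ (p , q) → disjoint (∈-map⁻ _ p) (∈-map⁻ _ q)
  where
  disjoint : ∀ {X : Subset (suc n)} →
             ∃[ Y ] (Y ∈ subsets n × X ≡ outside Vec.∷ Y) →
             ∃[ Z ] (Z ∈ subsets n × X ≡ inside Vec.∷ Z) → ⊥
  disjoint (_ , _ , refl) (_ , _ , ())

#edges : ∀ {n} → Hypergraph n → ℕ
#edges {n} H = length (filterᵇ H (subsets n))

record 𝒦⁰ (r n : ℕ) (E : Hypergraph n) : Set where
  field
    R0 : ∀ X → ∣ X ∣ ≤ r → X ∈ᴴ E
    R1 : ∀ A → A ∈ᴴ E → ∁ A ∈ᴴ E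

record 𝒦 (r n : ℕ) (E : Hypergraph n) : Set where
  field
    R0 : ∀ X → ∣ X ∣ ≤ r → X ∈ᴴ E
    R1 : ∀ A → A ∈ᴴ E → ∁ A ∈ᴴ E
    R2 : ∀ A B → A ∈ᴴ E → B ∈ᴴ E → ∣ A ∩ B ∣ ≥ r → (A ∪ B) ∈ᴴ E

-- The closures are predicates rather than Boolean functions, so that they can be
-- literally the intersection of all members of the class containing H.
cl : ∀ {n} → ℕ → Hypergraph n → Pred (Subset n) 0ℓ
cl {n} r H X = ∀ (E : Hypergraph n) → 𝒦 r n E → H ⊆ᴴ E → X ∈ᴴ E

cl⁰ : ∀ {n} → ℕ → Hypergraph n → Pred (Subset n) 0ℓ
cl⁰ {n} r H X = ∀ (E : Hypergraph n) → 𝒦⁰ r n E → H ⊆ᴴ E → X ∈ᴴ E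

Orthogonal : ∀ {n} → ℕ → Subset n → Subset n → Set
Orthogonal r A B = cl r ⟅ A , B ⟆ ≐ cl⁰ r ⟅ A , B ⟆

-- A and B need not be distinct, but the case A = B imposes nothing: A is always
-- r-orthogonal to itself.
CrossFree : ∀ {n} → ℕ → Hypergraph n → Set
CrossFree r H = ∀ A B → A ∈ᴴ H → B ∈ᴴ H → Orthogonal r A B

{-# OPTIONS --safe #-}

-- Let A and B have the same size k > r, with |A ∩ B| ≥ r and |∁ (A ∪ B)| > r.
-- Then A ∪ B lies in cl r {A , B}, whereas cl⁰ r {A , B} consists of A, B, their
-- complements, and the sets of size or cosize at most r; so r-orthogonality
-- forces A = B.  Hence a member of an r-cross-free hypergraph with r < |A| < n/2
-- is determined by its size and its first r elements: n^(r+1) choices.  When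
-- |A| = n/2 or |A| ≤ r, the first r + 1 elements suffice.  Members with more
-- than n/2 elements are counted through their complements.
module Submission where

open import Defs
open import Algebra.Lattice.Properties.BooleanAlgebra using (¬-involutive)
open import Data.Bool using (T; _∨_)
open import Data.Bool.Properties using (T?)
open import Data.Fin using (Fin; zero; suc; toℕ; fromℕ<; combine; funToFin; finToFun)
open import Data.Fin.Properties
  using (combine-injective; finToFun-funToFin; fromℕ<-injective; injective⇒≤; suc-injective)
open import Data.Fin.Subset using (Subset; inside; outside; ∁; ⊥; _∩_; _∪_; ∣_∣)
open import Data.Fin.Subset.Properties
  using (∣p∣≤n; ∣⊥∣≡0; ∣∁p∣≡n∸∣p∣; ∣p∩q∣≤∣p∣; ∣p∩q∣≤∣q∣; ∣p∣≤∣p∪q∣;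
         ∩-abs-∪; ∩-inverseʳ; ∩-comm; ∪-comm; ∪-∩-booleanAlgebra)
open import Data.List using (List; length; lookup)
open import Data.List.Membership.Propositional using (_∈_)
open import Data.List.Membership.Propositional.Properties using (∈-lookup; ∈-filter⁻)
import Data.List.Relation.Unary.All as All
open import Data.List.Relation.Unary.AllPairs using (_∷_)
open import Data.List.Relation.Unary.Unique.Propositional using (Unique)
open import Data.List.Relation.Unary.Unique.Propositional.Properties using (filter⁺)
open import Data.Nat using (ℕ; zero; suc; _+_; _*_; _^_; _⊓_; _≤_; _<_; _≤?_; _<?_; z≤n; s≤s; s≤s⁻¹; NonZero)
open import Data.Nat.Properties hiding (suc-injective; _≤?_; _<?_)
open import Data.Product using (∃-syntax; _×_; _,_; proj₁; proj₂)
open import Data.Sum using (inj₁; inj₂)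
open import Data.Unit using (tt)
open import Data.Vec using ([]; _∷_)
open import Function using (_∘_; Injective)
open import Relation.Binary.PropositionalEquality
open import Relation.Nullary using (Dec; does; yes; no; ¬_; contradiction)
open import Relation.Nullary.Decidable using (⌊_⌋; toWitness; fromWitness; dec-true; _×-dec_)
open import Relation.Unary using (_⊆_)

-- Counting lists without repetition by injective codes

lookup-injective : ∀ {A : Set} {xs : List A} → Unique xs → Injective _≡_ _≡_ (lookup xs)
lookup-injective (x∉ ∷ u) {zero}  {zero}  eq = refl
lookup-injective (x∉ ∷ u) {zero}  {suc j} eq = contradiction eq (All.lookup x∉ (∈-lookup j))
lookup-injective (x∉ ∷ u) {suc i} {zero}  eq = contradiction (sym eq) (All.lookup x∉ (∈-lookup i))
lookup-injective (x∉ ∷ u) {suc i} {suc j} eq = cong suc (lookup-injective u eq)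

-- Injectivity is asked for on members only, because the codes below are shown to separate sets only
-- under an orthogonality hypothesis.
injective-on⇒length≤ : ∀ {A : Set} {N} {xs : List A} → Unique xs → (f : A → Fin N) →
                       (∀ {x y} → x ∈ xs → y ∈ xs → f x ≡ f y → x ≡ y) → length xs ≤ N
injective-on⇒length≤ {xs = xs} u f inj =
  injective⇒≤ λ {i} {j} eq → lookup-injective u (inj (∈-lookup i) (∈-lookup j) eq)

-- Complements and cardinalities of unions and intersections

∁-involutive : ∀ {n} (p : Subset n) → ∁ (∁ p) ≡ p
∁-involutive {n} = ¬-involutive (∪-∩-booleanAlgebra n)

∣∁p∣+∣p∣≡n : ∀ {n} (p : Subset n) → ∣ ∁ p ∣ + ∣ p ∣ ≡ n
∣∁p∣+∣p∣≡n p = trans (cong (_+ ∣ p ∣) (∣∁p∣≡n∸∣p∣ p)) (m∸n+n≡m (∣p∣≤n p))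

∣p∪q∣+∣p∩q∣≡∣p∣+∣q∣ : ∀ {n} (p q : Subset n) → ∣ p ∪ q ∣ + ∣ p ∩ q ∣ ≡ ∣ p ∣ + ∣ q ∣
∣p∪q∣+∣p∩q∣≡∣p∣+∣q∣ []            []            = refl
∣p∪q∣+∣p∩q∣≡∣p∣+∣q∣ (inside  ∷ p) (inside  ∷ q) = cong suc
  (trans (+-suc _ _) (trans (cong suc (∣p∪q∣+∣p∩q∣≡∣p∣+∣q∣ p q)) (sym (+-suc _ _))))
∣p∪q∣+∣p∩q∣≡∣p∣+∣q∣ (inside  ∷ p) (outside ∷ q) = cong suc (∣p∪q∣+∣p∩q∣≡∣p∣+∣q∣ p q)
∣p∪q∣+∣p∩q∣≡∣p∣+∣q∣ (outside ∷ p) (inside  ∷ q) =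
  trans (cong suc (∣p∪q∣+∣p∩q∣≡∣p∣+∣q∣ p q)) (sym (+-suc _ _))
∣p∪q∣+∣p∩q∣≡∣p∣+∣q∣ (outside ∷ p) (outside ∷ q) = ∣p∪q∣+∣p∩q∣≡∣p∣+∣q∣ p q

∣p∣,∣q∣≤∣p∩q∣⇒p≡q : ∀ {n} (p q : Subset n) → ∣ p ∣ ≤ ∣ p ∩ q ∣ → ∣ q ∣ ≤ ∣ p ∩ q ∣ → p ≡ q
∣p∣,∣q∣≤∣p∩q∣⇒p≡q []            []            _ _ = refl
∣p∣,∣q∣≤∣p∩q∣⇒p≡q (inside  ∷ p) (inside  ∷ q) a b =
  cong (inside ∷_) (∣p∣,∣q∣≤∣p∩q∣⇒p≡q p q (s≤s⁻¹ a) (s≤s⁻¹ b))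
∣p∣,∣q∣≤∣p∩q∣⇒p≡q (inside  ∷ p) (outside ∷ q) a _ = contradiction (∣p∩q∣≤∣p∣ p q) (<⇒≱ a)
∣p∣,∣q∣≤∣p∩q∣⇒p≡q (outside ∷ p) (inside  ∷ q) _ b = contradiction (∣p∩q∣≤∣q∣ p q) (<⇒≱ b)
∣p∣,∣q∣≤∣p∩q∣⇒p≡q (outside ∷ p) (outside ∷ q) a b =
  cong (outside ∷_) (∣p∣,∣q∣≤∣p∩q∣⇒p≡q p q a b)

p∪q≡p⇒∣p∩q∣≡∣q∣ : ∀ {n} (p q : Subset n) → p ∪ q ≡ p → ∣ p ∩ q ∣ ≡ ∣ q ∣
p∪q≡p⇒∣p∩q∣≡∣q∣ p q eq = +-cancelˡ-≡ ∣ p ∣ _ _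
  (trans (cong (λ z → ∣ z ∣ + ∣ p ∩ q ∣) (sym eq)) (∣p∪q∣+∣p∩q∣≡∣p∣+∣q∣ p q))

-- Absorption gives `p ∩ (p ∪ q) ≡ p`, while `p ∩ ∁ p` is empty.
p∪q≡∁p⇒∣p∣≡0 : ∀ {n} (p q : Subset n) → p ∪ q ≡ ∁ p → ∣ p ∣ ≡ 0
p∪q≡∁p⇒∣p∣≡0 {n} p q eq = trans (cong ∣_∣ p≡⊥) (∣⊥∣≡0 n)
  where
  p≡⊥ : p ≡ ⊥
  p≡⊥ = trans (sym (∩-abs-∪ p q)) (trans (cong (p ∩_) eq) (∩-inverseʳ p))

-- Hypergraphs with two hyperedges

module _ {n} {A B : Subset n} where

  ⟅⟆-⊆⁺ : ∀ {E} → A ∈ᴴ E → B ∈ᴴ E → ⟅ A , B ⟆ ⊆ᴴ E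
  ⟅⟆-⊆⁺ a b X x with X ≟ˢ A | X ≟ˢ B
  ... | yes refl | _        = a
  ... | no _     | yes refl = b

  ⟅⟆-⊆⁻ˡ : ∀ {E} → ⟅ A , B ⟆ ⊆ᴴ E → A ∈ᴴ E
  ⟅⟆-⊆⁻ˡ sub = sub A (subst (λ b → T (b ∨ does (A ≟ˢ B))) (sym (dec-true (A ≟ˢ A) refl)) tt)

  ⟅⟆-⊆⁻ʳ : ∀ {E} → ⟅ A , B ⟆ ⊆ᴴ E → B ∈ᴴ E
  ⟅⟆-⊆⁻ʳ sub with sub B
  ... | s rewrite dec-true (B ≟ˢ B) refl with B ≟ˢ A
  ...   | yes _ = s tt
  ...   | no  _ = s tt

-- Closures and the consequence of orthogonality for sets of equal size

module _ (r : ℕ) {n : ℕ} where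

  cl⊆cl⁰ : Subset n → Subset n → Set
  cl⊆cl⁰ A B = cl r ⟅ A , B ⟆ ⊆ cl⁰ r ⟅ A , B ⟆

  -- By (R1), a hypergraph of either class contains `A` and `B` exactly when it contains their
  -- complements. This later reduces sets with more than n/2 elements to smaller ones.
  cl⊆cl⁰-∁ : ∀ {A B} → cl⊆cl⁰ A B → cl⊆cl⁰ (∁ A) (∁ B)
  cl⊆cl⁰-∁ {A} {B} orth {X} x∈cl E E∈𝒦⁰ ∁A∁B⊆E = orth x∈cl′ E E∈𝒦⁰
    (⟅⟆-⊆⁺ (uncomplement A (⟅⟆-⊆⁻ˡ ∁A∁B⊆E)) (uncomplement B (⟅⟆-⊆⁻ʳ {A = ∁ A} ∁A∁B⊆E)))
    where
    uncomplement : ∀ Y → ∁ Y ∈ᴴ E → Y ∈ᴴ E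
    uncomplement Y ∁Y∈E = subst (_∈ᴴ E) (∁-involutive Y) (𝒦⁰.R1 E∈𝒦⁰ (∁ Y) ∁Y∈E)

    x∈cl′ : cl r ⟅ A , B ⟆ X
    x∈cl′ F F∈𝒦 AB⊆F = x∈cl F F∈𝒦
      (⟅⟆-⊆⁺ (𝒦.R1 F∈𝒦 A (⟅⟆-⊆⁻ˡ AB⊆F)) (𝒦.R1 F∈𝒦 B (⟅⟆-⊆⁻ʳ {A = A} AB⊆F)))

  ∪∈cl : ∀ {A B : Subset n} → r ≤ ∣ A ∩ B ∣ → cl r ⟅ A , B ⟆ (A ∪ B)
  ∪∈cl {A} {B} r≤ E E∈𝒦 AB⊆E = 𝒦.R2 E∈𝒦 A B (⟅⟆-⊆⁻ˡ AB⊆E) (⟅⟆-⊆⁻ʳ {A = A} AB⊆E) r≤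

  -- An explicit list of candidates for `cl⁰ r ⟅ A , B ⟆`; the constructors come in complementary
  -- pairs.
  data Cl⁰ (A B : Subset n) : Subset n → Set where
    small   : ∀ {X} → ∣ X ∣ ≤ r → Cl⁰ A B X
    cosmall : ∀ {X} → ∣ ∁ X ∣ ≤ r → Cl⁰ A B X
    left    : Cl⁰ A B A
    right   : Cl⁰ A B B
    coleft  : Cl⁰ A B (∁ A)
    coright : Cl⁰ A B (∁ B)

  -- Deciding `Cl⁰` turns it into a Boolean hypergraph, over which `cl⁰` can be instantiated.
  Cl⁰? : ∀ A B X → Dec (Cl⁰ A B X)
  Cl⁰? A B X with ∣ X ∣ ≤? r | ∣ ∁ X ∣ ≤? r | X ≟ˢ A | X ≟ˢ B | X ≟ˢ ∁ A | X ≟ˢ ∁ B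
  ... | yes p | _     | _        | _        | _        | _        = yes (small p)
  ... | no _  | yes p | _        | _        | _        | _        = yes (cosmall p)
  ... | no _  | no _  | yes refl | _        | _        | _        = yes left
  ... | no _  | no _  | no _     | yes refl | _        | _        = yes right
  ... | no _  | no _  | no _     | no _     | yes refl | _        = yes coleft
  ... | no _  | no _  | no _     | no _     | no _     | yes refl = yes coright
  ... | no a  | no b  | no c     | no d     | no e     | no f     = no λ where
    (small p)   → a p
    (cosmall p) → b p
    left        → c refl
    right       → d refl
    coleft      → e refl
    coright     → f refl

  Cl⁰-∁ : ∀ {A B X} → Cl⁰ A B X → Cl⁰ A B (∁ X)
  Cl⁰-∁ {X = X} (small p) = cosmall (subst (λ Y → ∣ Y ∣ ≤ r) (sym (∁-involutive X)) p)
  Cl⁰-∁ (cosmall p)       = small p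
  Cl⁰-∁ left              = coleft
  Cl⁰-∁ right             = coright
  Cl⁰-∁ {A} {B} coleft    = subst (Cl⁰ A B) (sym (∁-involutive A)) left
  Cl⁰-∁ {A} {B} coright   = subst (Cl⁰ A B) (sym (∁-involutive B)) right

  -- `Cl⁰ A B` is itself a member of `𝒦⁰` containing `A` and `B`, hence one of the hypergraphs being
  -- intersected.
  cl⁰⊆Cl⁰ : ∀ {A B} → cl⁰ r ⟅ A , B ⟆ ⊆ Cl⁰ A B
  cl⁰⊆Cl⁰ {A} {B} x∈cl⁰ = toWitness (x∈cl⁰ E E∈𝒦⁰
    (⟅⟆-⊆⁺ {A = A} {B} {E} (fromWitness {a? = Cl⁰? A B A} left) (fromWitness {a? = Cl⁰? A B B} right)))
    where
    E : Hypergraph n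
    E X = ⌊ Cl⁰? A B X ⌋

    E∈𝒦⁰ : 𝒦⁰ r n E
    E∈𝒦⁰ = record
      { R0 = λ X p → fromWitness {a? = Cl⁰? A B X} (small p)
      ; R1 = λ X p → fromWitness {a? = Cl⁰? A B (∁ X)} (Cl⁰-∁ (toWitness p))
      }

  -- Orthogonality puts `A ∪ B` into `Cl⁰ A B`. The size bounds exclude `small` and `cosmall`, a
  -- complement would make `A` or `B` empty, and otherwise one set includes the other, so equal
  -- sizes give equality.
  equal-size⇒≡ : ∀ {A B} → cl⊆cl⁰ A B → ∣ A ∣ ≡ ∣ B ∣ → r < ∣ A ∣ → r ≤ ∣ A ∩ B ∣ →
                 r < ∣ ∁ (A ∪ B) ∣ → A ≡ B
  equal-size⇒≡ {A} {B} orth ∣A∣≡∣B∣ r<∣A∣ r≤∣A∩B∣ r<∣∁A∪B∣ = by-cases refl (cl⁰⊆Cl⁰ (orth (∪∈cl r≤∣A∩B∣)))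
    where
    ∣∩∣≡∣B∣⇒A≡B : ∣ A ∩ B ∣ ≡ ∣ B ∣ → A ≡ B
    ∣∩∣≡∣B∣⇒A≡B eq = ∣p∣,∣q∣≤∣p∩q∣⇒p≡q A B (≤-reflexive (trans ∣A∣≡∣B∣ (sym eq))) (≤-reflexive (sym eq))

    -- The index is a variable tied to `A ∪ B` by an equation, since `A ∪ B` does not unify with `A`
    -- or `∁ A` in a pattern match.
    by-cases : ∀ {X} → X ≡ A ∪ B → Cl⁰ A B X → A ≡ B
    by-cases eq (small p)   =
      contradiction (≤-trans (∣p∣≤∣p∪q∣ A B) (subst (λ X → ∣ X ∣ ≤ r) eq p)) (<⇒≱ r<∣A∣)
    by-cases eq (cosmall p) = contradiction (subst (λ X → ∣ ∁ X ∣ ≤ r) eq p) (<⇒≱ r<∣∁A∪B∣)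
    by-cases eq left        = ∣∩∣≡∣B∣⇒A≡B (p∪q≡p⇒∣p∩q∣≡∣q∣ A B (sym eq))
    by-cases eq right       = ∣∩∣≡∣B∣⇒A≡B (trans (cong ∣_∣ (∩-comm A B))
      (trans (p∪q≡p⇒∣p∩q∣≡∣q∣ B A (trans (∪-comm B A) (sym eq))) ∣A∣≡∣B∣))
    by-cases eq coleft      =
      contradiction (p∪q≡∁p⇒∣p∣≡0 A B (sym eq)) (m<n⇒n≢0 r<∣A∣)
    by-cases eq coright     =
      contradiction (trans ∣A∣≡∣B∣ (p∪q≡∁p⇒∣p∣≡0 B A (trans (∪-comm B A) (sym eq)))) (m<n⇒n≢0 r<∣A∣)

  -- Inclusion-exclusion gives |∁ (A ∪ B)| = n - 2|A| + |A ∩ B|; the hypothesis states the bound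
  -- without subtraction.
  ∣∁∪∣-bound : ∀ {A B : Subset n} → ∣ A ∣ ≡ ∣ B ∣ → 2 * ∣ A ∣ + r < n + ∣ A ∩ B ∣ → r < ∣ ∁ (A ∪ B) ∣
  ∣∁∪∣-bound {A} {B} ∣A∣≡∣B∣ h = +-cancelˡ-< (2 * ∣ A ∣) r ∣ ∁ (A ∪ B) ∣ (begin-strict
    2 * ∣ A ∣ + r                             <⟨ h ⟩
    n + ∣ A ∩ B ∣                             ≡⟨ cong (_+ ∣ A ∩ B ∣) (∣∁p∣+∣p∣≡n (A ∪ B)) ⟨
    ∣ ∁ (A ∪ B) ∣ + ∣ A ∪ B ∣ + ∣ A ∩ B ∣     ≡⟨ +-assoc ∣ ∁ (A ∪ B) ∣ _ _ ⟩
    ∣ ∁ (A ∪ B) ∣ + (∣ A ∪ B ∣ + ∣ A ∩ B ∣)   ≡⟨ cong (∣ ∁ (A ∪ B) ∣ +_) (∣p∪q∣+∣p∩q∣≡∣p∣+∣q∣ A B) ⟩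
    ∣ ∁ (A ∪ B) ∣ + (∣ A ∣ + ∣ B ∣)           ≡⟨ cong (λ k → ∣ ∁ (A ∪ B) ∣ + (∣ A ∣ + k)) ∣A∣≡∣B∣ ⟨
    ∣ ∁ (A ∪ B) ∣ + (∣ A ∣ + ∣ A ∣)           ≡⟨ cong (λ k → ∣ ∁ (A ∪ B) ∣ + (∣ A ∣ + k)) (+-identityʳ ∣ A ∣) ⟨
    ∣ ∁ (A ∪ B) ∣ + 2 * ∣ A ∣                 ≡⟨ +-comm ∣ ∁ (A ∪ B) ∣ _ ⟩
    2 * ∣ A ∣ + ∣ ∁ (A ∪ B) ∣                 ∎)
    where open ≤-Reasoning

-- Encoding the first elements of a set

-- nth A i is the i-th smallest element of A, counting from 0; it is n when
-- i ≥ ∣ A ∣.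
nth : ∀ {n} → Subset n → ℕ → Fin (suc n)
nth []            i       = zero
nth (inside  ∷ A) zero    = zero
nth (inside  ∷ A) (suc i) = suc (nth A i)
nth (outside ∷ A) i       = suc (nth A i)

-- The first min(|A|, k) values of `nth A` are genuine elements, hence below the default n; where
-- `nth B` agrees, it also yields an element of `B`.
nth-agree : ∀ {n} k (A B : Subset n) → (∀ (i : Fin k) → nth A (toℕ i) ≡ nth B (toℕ i)) →
            ∣ A ∣ ⊓ k ≤ ∣ A ∩ B ∣
nth-agree zero    A             B             eq = ≤-trans (≤-reflexive (⊓-zeroʳ ∣ A ∣)) z≤n
nth-agree (suc k) []            []            eq = z≤n
nth-agree (suc k) (inside  ∷ A) (inside  ∷ B) eq = s≤s (nth-agree k A B (suc-injective ∘ eq ∘ suc))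
nth-agree (suc k) (inside  ∷ A) (outside ∷ B) eq = contradiction (eq zero) λ ()
nth-agree (suc k) (outside ∷ A) (inside  ∷ B) eq = contradiction (eq zero) λ ()
nth-agree (suc k) (outside ∷ A) (outside ∷ B) eq = nth-agree (suc k) A B (suc-injective ∘ eq)

-- The base is `suc n` because the default n is a possible digit.
prefix : ∀ {n} k → Subset n → Fin (suc n ^ k)
prefix k A = funToFin (λ (i : Fin k) → nth A (toℕ i))

prefix-≡ : ∀ {n} k (A B : Subset n) → prefix k A ≡ prefix k B → ∣ A ∣ ⊓ k ≤ ∣ A ∩ B ∣
prefix-≡ {n} k A B eq = nth-agree k A B λ i →
  trans (sym (finToFun-funToFin (λ (j : Fin k) → nth A (toℕ j)) i))
    (trans (cong (λ c → finToFun {suc n} {k} c i) eq)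
      (finToFun-funToFin (λ (j : Fin k) → nth B (toℕ j)) i))

m⊓n≤o∧o<n⇒m≤o : ∀ {m n o} → m ⊓ n ≤ o → o < n → m ≤ o
m⊓n≤o∧o<n⇒m≤o {m} {n} p o<n with ≤-total m n
... | inj₁ m≤n = ≤-trans (≤-reflexive (sym (m≤n⇒m⊓n≡m m≤n))) p
... | inj₂ n≤m = contradiction (≤-trans (≤-reflexive (sym (m≥n⇒m⊓n≡n n≤m))) p) (<⇒≱ o<n)

-- Codes that separate orthogonal sets

module _ (r : ℕ) {n : ℕ} where

  Middle : Subset n → Set
  Middle A = r < ∣ A ∣ × 2 * ∣ A ∣ < n

  middle? : ∀ A → Dec (Middle A)
  middle? A = (r <? ∣ A ∣) ×-dec (2 * ∣ A ∣ <? n)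

  size : Subset n → Fin (suc n)
  size A = fromℕ< (s≤s (∣p∣≤n A))

  -- The leading bit keeps the two kinds of set apart. A size with r elements and a list of r + 1
  -- elements both take `suc n ^ suc r` values.
  lightCode : Subset n → Fin (2 * suc n ^ suc r)
  lightCode A with middle? A
  ... | yes _ = combine {2} {suc n ^ suc r} zero (combine (size A) (prefix r A))
  ... | no  _ = combine {2} {suc n ^ suc r} (suc zero) (prefix (suc r) A)

  -- The strict inequality 2|A| < n supplies the slack that `∣∁∪∣-bound` requires, so |A ∩ B| ≥ r is
  -- enough.
  middle-injective : ∀ {A B} → cl⊆cl⁰ r A B → Middle A →
                     ∣ A ∣ ≡ ∣ B ∣ → prefix r A ≡ prefix r B → A ≡ B
  middle-injective {A} {B} orth (r<∣A∣ , 2∣A∣<n) ∣A∣≡∣B∣ eq =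
    equal-size⇒≡ r orth ∣A∣≡∣B∣ r<∣A∣ r≤∣A∩B∣ (∣∁∪∣-bound r {A = A} ∣A∣≡∣B∣ (+-mono-<-≤ 2∣A∣<n r≤∣A∩B∣))
    where
    r≤∣A∩B∣ : r ≤ ∣ A ∩ B ∣
    r≤∣A∩B∣ = ≤-trans (≤-reflexive (sym (m≥n⇒m⊓n≡n (<⇒≤ r<∣A∣)))) (prefix-≡ r A B eq)

  half : ∀ {A} → 2 * ∣ A ∣ ≤ n → ¬ Middle A → r < ∣ A ∣ → 2 * ∣ A ∣ ≡ n
  half 2∣A∣≤n ¬mid r<∣A∣ = ≤-antisym 2∣A∣≤n (≮⇒≥ λ 2∣A∣<n → ¬mid (r<∣A∣ , 2∣A∣<n))

  nonmiddle-injective : ∀ {A B} → cl⊆cl⁰ r A B → 2 * ∣ A ∣ ≤ n → 2 * ∣ B ∣ ≤ n → ¬ Middle A → ¬ Middle B →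
                        prefix (suc r) A ≡ prefix (suc r) B → A ≡ B
  nonmiddle-injective {A} {B} orth 2∣A∣≤n 2∣B∣≤n ¬midA ¬midB eq with r <? ∣ A ∩ B ∣
  -- With at most r common elements, agreement on r + 1 entries means that both sets were exhausted,
  -- so each lies in the intersection.
  ... | no r≮ = ∣p∣,∣q∣≤∣p∩q∣⇒p≡q A B (m⊓n≤o∧o<n⇒m≤o (prefix-≡ (suc r) A B eq) (≰⇒> r≮))
    (m⊓n≤o∧o<n⇒m≤o (subst (λ X → ∣ B ∣ ⊓ suc r ≤ ∣ X ∣) (∩-comm B A) (prefix-≡ (suc r) B A (sym eq))) (≰⇒> r≮))
  -- Both sets now have exactly n/2 elements; the slack comes from the (r + 1)-st common element
  -- instead.
  ... | yes r< = equal-size⇒≡ r orth ∣A∣≡∣B∣ r<∣A∣ (<⇒≤ r<)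
      (∣∁∪∣-bound r {A = A} ∣A∣≡∣B∣ (+-mono-≤-< (≤-reflexive 2∣A∣≡n) r<))
    where
    r<∣A∣ : r < ∣ A ∣
    r<∣A∣ = <-≤-trans r< (∣p∩q∣≤∣p∣ A B)

    2∣A∣≡n : 2 * ∣ A ∣ ≡ n
    2∣A∣≡n = half {A} 2∣A∣≤n ¬midA r<∣A∣

    ∣A∣≡∣B∣ : ∣ A ∣ ≡ ∣ B ∣
    ∣A∣≡∣B∣ = *-cancelˡ-≡ ∣ A ∣ ∣ B ∣ 2
      (trans 2∣A∣≡n (sym (half {B} 2∣B∣≤n ¬midB (<-≤-trans r< (∣p∩q∣≤∣q∣ A B)))))

  lightCode-injective : ∀ {A B} → cl⊆cl⁰ r A B → 2 * ∣ A ∣ ≤ n → 2 * ∣ B ∣ ≤ n →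
                        lightCode A ≡ lightCode B → A ≡ B
  lightCode-injective {A} {B} orth 2∣A∣≤n 2∣B∣≤n eq with middle? A | middle? B
  ... | yes midA | yes _ =
    let sizes , prefixes = combine-injective (size A) _ (size B) _
                             (proj₂ (combine-injective {2} zero _ zero _ eq))
    in middle-injective orth midA (fromℕ<-injective _ _ _ _ sizes) prefixes
  ... | no ¬midA | no ¬midB = nonmiddle-injective orth 2∣A∣≤n 2∣B∣≤n ¬midA ¬midB
    (proj₂ (combine-injective {2} (suc zero) (prefix (suc r) A) (suc zero) (prefix (suc r) B) eq))
  ... | yes _ | no _ =
    contradiction (proj₁ (combine-injective {2} zero _ (suc zero) (prefix (suc r) B) eq)) λ ()
  ... | no _ | yes _ =
    contradiction (proj₁ (combine-injective {2} (suc zero) (prefix (suc r) A) zero _ eq)) λ ()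

  code : Subset n → Fin (2 * (2 * suc n ^ suc r))
  code A with 2 * ∣ A ∣ ≤? n
  ... | yes _ = combine {2} zero (lightCode A)
  ... | no  _ = combine {2} (suc zero) (lightCode (∁ A))

  ∁-light : ∀ (A : Subset n) → ¬ 2 * ∣ A ∣ ≤ n → 2 * ∣ ∁ A ∣ ≤ n
  ∁-light A heavy = +-cancelʳ-≤ n (2 * ∣ ∁ A ∣) n (begin
    2 * ∣ ∁ A ∣ + n           ≤⟨ +-monoʳ-≤ (2 * ∣ ∁ A ∣) (≰⇒≥ heavy) ⟩
    2 * ∣ ∁ A ∣ + 2 * ∣ A ∣   ≡⟨ *-distribˡ-+ 2 ∣ ∁ A ∣ ∣ A ∣ ⟨
    2 * (∣ ∁ A ∣ + ∣ A ∣)     ≡⟨ cong (2 *_) (∣∁p∣+∣p∣≡n A) ⟩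
    n + (n + 0)               ≡⟨ cong (n +_) (+-identityʳ n) ⟩
    n + n                     ∎)
    where open ≤-Reasoning

  code-injective : ∀ {A B} → cl⊆cl⁰ r A B → code A ≡ code B → A ≡ B
  code-injective {A} {B} orth eq with 2 * ∣ A ∣ ≤? n | 2 * ∣ B ∣ ≤? n
  ... | yes lightA | yes lightB = lightCode-injective orth lightA lightB
    (proj₂ (combine-injective {2} zero (lightCode A) zero (lightCode B) eq))
  -- Orthogonality passes to the complements, which have at most n/2 elements.
  ... | no heavyA | no heavyB = trans (sym (∁-involutive A)) (trans (cong ∁ ∁A≡∁B) (∁-involutive B))
    where
    ∁A≡∁B : ∁ A ≡ ∁ B
    ∁A≡∁B = lightCode-injective (cl⊆cl⁰-∁ r orth) (∁-light A heavyA) (∁-light B heavyB)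
      (proj₂ (combine-injective {2} (suc zero) (lightCode (∁ A)) (suc zero) (lightCode (∁ B)) eq))
  ... | yes _ | no _ =
    contradiction (proj₁ (combine-injective {2} zero (lightCode A) (suc zero) (lightCode (∁ B)) eq)) λ ()
  ... | no _ | yes _ =
    contradiction (proj₁ (combine-injective {2} (suc zero) (lightCode (∁ A)) zero (lightCode B) eq)) λ ()

  #edges≤ : ∀ (H : Hypergraph n) → CrossFree r H → #edges H ≤ 2 * (2 * suc n ^ suc r)
  #edges≤ H cf = injective-on⇒length≤ (filter⁺ (T? ∘ H) (subsets-unique n)) code λ {A} {B} A∈ B∈ →
    code-injective (proj₁ (cf A B (proj₂ (∈-filter⁻ (T? ∘ H) {xs = subsets n} A∈))
                                  (proj₂ (∈-filter⁻ (T? ∘ H) {xs = subsets n} B∈))))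

-- The bound as a multiple of a power of n

^-distribʳ-* : ∀ m n k → (m * n) ^ k ≡ m ^ k * n ^ k
^-distribʳ-* m n zero    = refl
^-distribʳ-* m n (suc k) =
  trans (cong (m * n *_) (^-distribʳ-* m n k)) ([m*n]*[o*p]≡[m*o]*[n*p] m n (m ^ k) (n ^ k))

suc[n]≤2*n : ∀ n .{{_ : NonZero n}} → suc n ≤ 2 * n
suc[n]≤2*n (suc n) = s≤s (≤-trans (m≤n+m (suc n) n) (≤-reflexive (cong (n +_) (sym (+-identityʳ (suc n))))))

theorem2 : (r : ℕ) → ∃[ C ] (0 < C × (∀ (n : ℕ) .{{_ : NonZero n}} (H : Hypergraph n) →
    CrossFree r H → #edges H ≤ C * n ^ (r + 1)))
-- The factor 4 counts the two leading bits of `code`; `2 ^ (r + 1)` pays for replacing `suc n` by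
-- `2 * n`, which needs n ≥ 1.
theorem2 r = 4 * 2 ^ (r + 1) , *-mono-≤ {1} {4} (s≤s z≤n) (m^n>0 2 (r + 1)) , bound
  where
  open ≤-Reasoning
  bound : ∀ n .{{_ : NonZero n}} (H : Hypergraph n) → CrossFree r H → #edges H ≤ 4 * 2 ^ (r + 1) * n ^ (r + 1)
  bound n H cf = begin
    #edges H                        ≤⟨ #edges≤ r H cf ⟩
    2 * (2 * suc n ^ suc r)         ≡⟨ *-assoc 2 2 (suc n ^ suc r) ⟨
    4 * suc n ^ suc r               ≡⟨ cong (λ k → 4 * suc n ^ k) (+-comm r 1) ⟨
    4 * suc n ^ (r + 1)             ≤⟨ *-monoʳ-≤ 4 (^-monoˡ-≤ (r + 1) (suc[n]≤2*n n)) ⟩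
    4 * (2 * n) ^ (r + 1)           ≡⟨ cong (4 *_) (^-distribʳ-* 2 n (r + 1)) ⟩
    4 * (2 ^ (r + 1) * n ^ (r + 1)) ≡⟨ *-assoc 4 (2 ^ (r + 1)) _ ⟨
    4 * 2 ^ (r + 1) * n ^ (r + 1)   ∎
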